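{- Let $N\ge 2$ and $l\ge 1$ be integers. Each element $w \in \bar{\mathcal{A}}^l$ has a unique immediate successor in $\bar{\mathcal{A}}^l$ and a unique immediate predecessor in $\bar{\mathcal{A}}^l$.
   Context: $F_N$ is the free monoid of all finite words with letters in $\mathbb{Z}/N\mathbb{Z}$ (identity: the empty word $\varepsilon$); juxtaposition of letters is concatenation. $\pi : F_N \to \mathrm{SL}_2(\mathbb{Z}/N\mathbb{Z})$ is the monoid homomorphism with $\pi(\alpha) = \begin{bmatrix} 0 & 1 \\ -1 & \alpha \end{bmatrix}$ for each letter $\alpha$, so $\pi(\alpha_1\cdots\alpha_l)=\pi(\alpha_1)\cdots\pi(\alpha_l)$ and $\pi(\varepsilon)$ is the identity matrix. On $(\mathbb{Z}/N\mathbb{Z})^2\smallsetminus\{0\}$ (column vectors) let $u\sim' v$ if and only if $u=\lambda v$ for some $\lambda\in(\mathbb{Z}/N\mathbb{Z})^\times$; $\mathrm{SL}_2(\mathbb{Z}/N\mathbb{Z})$ acts on the set of $\sim'$-classes by left multiplication. $\bar{\mathcal{A}} = \left\{w \in F_N : \pi(w)\begin{bmatrix} 0 \\ 1 \end{bmatrix} = \begin{bmatrix} 1 \\ 0 \end{bmatrix} \text{ as } \sim'\text{ -classes}\right\}$. $F_N^l$ is the set of words of length $l$ and $\bar{\mathcal{A}}^l=F_N^l\cap\bar{\mathcal{A}}$. Given two words of the form $w = \alpha_0\alpha_1\cdots\alpha_{l-1}$ and $w' = \alpha_1\alpha_2\cdots\alpha_l$ in $F_N$, $w'$ is called an immediate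 successor of $w$ and $w$ an immediate predecessor of $w'$. -}

module Defs where

open import Algebra.Bundles using (CommutativeRing)
open import Algebra.Definitions using (Invertible)
import Algebra.Solver.Ring as RingSolver
open import Algebra.Solver.Ring.AlmostCommutativeRing using (fromCommutativeRing; _-Raw-AlmostCommutative⟶_)
open import Data.Fin.Base using (Fin; toℕ; fromℕ<)
open import Data.Fin.Properties using (toℕ<n; toℕ-fromℕ<; fromℕ<-toℕ; fromℕ<-cong)
open import Data.Integer.Base as ℤ using (ℤ; +_; 0ℤ; 1ℤ; _⊖_; ∣_∣)
open import Data.Integer.Divisibility.Signed using (_∣_; divides; ∣⇒∣ᵤ)
open import Data.Integer.DivMod using (_%ℕ_; _/ℕ_; n%ℕd<d; a≡a%ℕn+[a/ℕn]*n)
import Data.Integer.Properties as ℤ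
import Data.Integer.Solver as ℤ
open import Data.List.Base using (List; _∷_; _∷ʳ_; foldr; length)
open import Data.Maybe.Base using (Maybe)
import Data.Maybe.Base as Maybe
open import Data.Nat.Base as ℕ using (ℕ; zero; suc; NonTrivial; NonZero; nonTrivial⇒nonZero; nonTrivial⇒n>1)
import Data.Nat.Divisibility as ℕ
import Data.Nat.DivMod as ℕ
import Data.Nat.Properties as ℕ
open import Data.Product.Base using (∃; _×_; _,_; proj₁; proj₂)
open import Level using (0ℓ)
open import Relation.Binary.PropositionalEquality
open import Relation.Nullary.Decidable using (dec⇒maybe)
open import Relation.Nullary.Negation using (contradiction)
open import Relation.Unary using (Pred; _∩_)

infix 4 _ImmediateSuccessorOf_ _ImmediatePredecessorOf_

record _ImmediateSuccessorOf_ {A : Set} (w′ w : List A) : Set where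
  constructor immediateSuccessor
  field
    first  : A
    middle : List A
    last   : A
    w≡     : w  ≡ first ∷ middle
    w′≡    : w′ ≡ middle ∷ʳ last

_ImmediatePredecessorOf_ : {A : Set} → List A → List A → Set
w ImmediatePredecessorOf w′ = w′ ImmediateSuccessorOf w

module Modulo (N : ℕ) .{{N≥2 : NonTrivial N}} where

  private instance
    N≢0 : NonZero N
    N≢0 = nonTrivial⇒nonZero N

  -- A residue class is represented by its least non-negative element, so
  -- that equality of residues (hence of words) is _≡_.
  ℤ/N : Set
  ℤ/N = Fin N

  reduce : ℤ → ℤ/N
  reduce i = fromℕ< (n%ℕd<d i N)

  lift : ℤ/N → ℤ
  lift a = + toℕ a

  infixl 6 _+_ _-_
  infixl 7 _*_
  infix  8 -_

  _+_ _*_ : ℤ/N → ℤ/N → ℤ/N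
  a + b = reduce (lift a ℤ.+ lift b)
  a * b = reduce (lift a ℤ.* lift b)

  -_ : ℤ/N → ℤ/N
  - a = reduce (ℤ.- lift a)

  _-_ : ℤ/N → ℤ/N → ℤ/N
  a - b = a + (- b)

  0# 1# : ℤ/N
  0# = reduce 0ℤ
  1# = reduce 1ℤ

  module _ where
    open ℤ.+-*-Solver

    reduce-cong : ∀ i j → + N ∣ i ℤ.- j → reduce i ≡ reduce j
    reduce-cong i j (divides q i-j≡qN) =
      fromℕ<-cong r s r≡s (n%ℕd<d i N) (n%ℕd<d j N)
      where
      r s : ℕ
      r = i %ℕ N
      s = j %ℕ N

      r⊖s : r ⊖ s ≡ (q ℤ.- (i /ℕ N) ℤ.+ (j /ℕ N)) ℤ.* + N
      r⊖s = begin
        r ⊖ s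
          ≡⟨ ℤ.m-n≡m⊖n r s ⟨
        + r ℤ.- + s
          ≡⟨ solve 5 (λ r s x y n → r :- s := (r :+ x :* n) :- (s :+ y :* n) :- (x :- y) :* n) refl
               (+ r) (+ s) (i /ℕ N) (j /ℕ N) (+ N) ⟩
        (+ r ℤ.+ (i /ℕ N) ℤ.* + N) ℤ.- (+ s ℤ.+ (j /ℕ N) ℤ.* + N) ℤ.- ((i /ℕ N) ℤ.- (j /ℕ N)) ℤ.* + N
          ≡⟨ cong₂ (λ x y → x ℤ.- y ℤ.- ((i /ℕ N) ℤ.- (j /ℕ N)) ℤ.* + N)
               (a≡a%ℕn+[a/ℕn]*n i N) (a≡a%ℕn+[a/ℕn]*n j N) ⟨
        i ℤ.- j ℤ.- ((i /ℕ N) ℤ.- (j /ℕ N)) ℤ.* + N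
          ≡⟨ cong (ℤ._- ((i /ℕ N) ℤ.- (j /ℕ N)) ℤ.* + N) i-j≡qN ⟩
        q ℤ.* + N ℤ.- ((i /ℕ N) ℤ.- (j /ℕ N)) ℤ.* + N
          ≡⟨ solve 4 (λ q x y n → q :* n :- (x :- y) :* n := (q :- x :+ y) :* n) refl
               q (i /ℕ N) (j /ℕ N) (+ N) ⟩
        (q ℤ.- (i /ℕ N) ℤ.+ (j /ℕ N)) ℤ.* + N
          ∎
        where open ≡-Reasoning

      small : ∣ r ⊖ s ∣ ℕ.< N
      small = ℕ.≤-<-trans (ℤ.∣m⊝n∣≤m⊔n r s) (ℕ.⊔-lub (n%ℕd<d i N) (n%ℕd<d j N))

      multiple<N⇒0 : ∀ k → N ℕ.∣ k → k ℕ.< N → k ≡ 0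
      multiple<N⇒0 zero      _   _   = refl
      multiple<N⇒0 k@(suc _) N∣k k<N = contradiction N∣k (ℕ.>⇒∤ k<N)

      r≡s : r ≡ s
      r≡s = ℤ.+-injective (ℤ.i-j≡0⇒i≡j (+ r) (+ s) (trans (ℤ.m-n≡m⊖n r s)
        (ℤ.∣i∣≡0⇒i≡0 (multiple<N⇒0 _ (∣⇒∣ᵤ {+ N} (divides (q ℤ.- (i /ℕ N) ℤ.+ (j /ℕ N)) r⊖s)) small))))

    lift-reduce : ∀ i → lift (reduce i) ≡ i ℤ.- (i /ℕ N) ℤ.* + N
    lift-reduce i = begin
      + toℕ (reduce i)
        ≡⟨ cong +_ (toℕ-fromℕ< (n%ℕd<d i N)) ⟩
      + (i %ℕ N)
        ≡⟨ solve 2 (λ r qn → r := r :+ qn :- qn) refl (+ (i %ℕ N)) ((i /ℕ N) ℤ.* + N) ⟩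
      + (i %ℕ N) ℤ.+ (i /ℕ N) ℤ.* + N ℤ.- (i /ℕ N) ℤ.* + N
        ≡⟨ cong (ℤ._- (i /ℕ N) ℤ.* + N) (a≡a%ℕn+[a/ℕn]*n i N) ⟨
      i ℤ.- (i /ℕ N) ℤ.* + N
        ∎
      where open ≡-Reasoning

    reduce-lift : ∀ a → reduce (lift a) ≡ a
    reduce-lift a = trans
      (fromℕ<-cong _ _ (ℕ.m<n⇒m%n≡m (toℕ<n a)) (n%ℕd<d (lift a) N) (toℕ<n a))
      (fromℕ<-toℕ a (toℕ<n a))

    +-reduceˡ : ∀ i b → reduce i + b ≡ reduce (i ℤ.+ lift b)
    +-reduceˡ i b = reduce-cong (lift (reduce i) ℤ.+ lift b) (i ℤ.+ lift b) (divides (ℤ.- (i /ℕ N)) (trans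
      (cong (λ x → x ℤ.+ lift b ℤ.- (i ℤ.+ lift b)) (lift-reduce i))
      (solve 4 (λ i q n b → i :- q :* n :+ b :- (i :+ b) := (:- q) :* n) refl i (i /ℕ N) (+ N) (lift b))))

    *-reduceˡ : ∀ i b → reduce i * b ≡ reduce (i ℤ.* lift b)
    *-reduceˡ i b = reduce-cong (lift (reduce i) ℤ.* lift b) (i ℤ.* lift b) (divides (ℤ.- ((i /ℕ N) ℤ.* lift b)) (trans
      (cong (λ x → x ℤ.* lift b ℤ.- i ℤ.* lift b) (lift-reduce i))
      (solve 4 (λ i q n b → (i :- q :* n) :* b :- i :* b := (:- (q :* b)) :* n) refl i (i /ℕ N) (+ N) (lift b))))

    -‿reduce : ∀ i → - reduce i ≡ reduce (ℤ.- i)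
    -‿reduce i = reduce-cong (ℤ.- lift (reduce i)) (ℤ.- i) (divides (i /ℕ N) (trans
      (cong (λ x → ℤ.- x ℤ.- ℤ.- i) (lift-reduce i))
      (solve 3 (λ i q n → :- (i :- q :* n) :- (:- i) := q :* n) refl i (i /ℕ N) (+ N))))

  +-comm : ∀ a b → a + b ≡ b + a
  +-comm a b = cong reduce (ℤ.+-comm (lift a) (lift b))

  *-comm : ∀ a b → a * b ≡ b * a
  *-comm a b = cong reduce (ℤ.*-comm (lift a) (lift b))

  +-reduceʳ : ∀ a j → a + reduce j ≡ reduce (lift a ℤ.+ j)
  +-reduceʳ a j = trans (+-comm a (reduce j)) (trans (+-reduceˡ j a) (cong reduce (ℤ.+-comm j (lift a))))

  *-reduceʳ : ∀ a j → a * reduce j ≡ reduce (lift a ℤ.* j)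
  *-reduceʳ a j = trans (*-comm a (reduce j)) (trans (*-reduceˡ j a) (cong reduce (ℤ.*-comm j (lift a))))

  reduce-+ : ∀ i j → reduce (i ℤ.+ j) ≡ reduce i + reduce j
  reduce-+ i j = sym (trans (+-reduceˡ i (reduce j)) (reduce-cong (i ℤ.+ lift (reduce j)) (i ℤ.+ j) (divides (ℤ.- (j /ℕ N)) (trans
    (cong (λ x → i ℤ.+ x ℤ.- (i ℤ.+ j)) (lift-reduce j))
    (solve 4 (λ i j q n → i :+ (j :- q :* n) :- (i :+ j) := (:- q) :* n) refl i j (j /ℕ N) (+ N))))))
    where open ℤ.+-*-Solver

  reduce-* : ∀ i j → reduce (i ℤ.* j) ≡ reduce i * reduce j
  reduce-* i j = sym (trans (*-reduceˡ i (reduce j)) (reduce-cong (i ℤ.* lift (reduce j)) (i ℤ.* j) (divides (ℤ.- (i ℤ.* (j /ℕ N))) (trans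
    (cong (λ x → i ℤ.* x ℤ.- i ℤ.* j) (lift-reduce j))
    (solve 4 (λ i j q n → i :* (j :- q :* n) :- i :* j := (:- (i :* q)) :* n) refl i j (j /ℕ N) (+ N))))))
    where open ℤ.+-*-Solver

  +-assoc : ∀ a b c → (a + b) + c ≡ a + (b + c)
  +-assoc a b c = trans (+-reduceˡ (lift a ℤ.+ lift b) c)
    (trans (cong reduce (ℤ.+-assoc (lift a) (lift b) (lift c))) (sym (+-reduceʳ a (lift b ℤ.+ lift c))))

  *-assoc : ∀ a b c → (a * b) * c ≡ a * (b * c)
  *-assoc a b c = trans (*-reduceˡ (lift a ℤ.* lift b) c)
    (trans (cong reduce (ℤ.*-assoc (lift a) (lift b) (lift c))) (sym (*-reduceʳ a (lift b ℤ.* lift c))))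

  +-identityˡ : ∀ a → 0# + a ≡ a
  +-identityˡ a = trans (+-reduceˡ 0ℤ a) (trans (cong reduce (ℤ.+-identityˡ (lift a))) (reduce-lift a))

  *-identityˡ : ∀ a → 1# * a ≡ a
  *-identityˡ a = trans (*-reduceˡ 1ℤ a) (trans (cong reduce (ℤ.*-identityˡ (lift a))) (reduce-lift a))

  -‿inverseˡ : ∀ a → - a + a ≡ 0#
  -‿inverseˡ a = trans (+-reduceˡ (ℤ.- lift a) a) (cong reduce (ℤ.+-inverseˡ (lift a)))

  *-distribˡ-+ : ∀ a b c → a * (b + c) ≡ a * b + a * c
  *-distribˡ-+ a b c = trans (*-reduceʳ a (lift b ℤ.+ lift c))
    (trans (cong reduce (ℤ.*-distribˡ-+ (lift a) (lift b) (lift c))) (reduce-+ (lift a ℤ.* lift b) (lift a ℤ.* lift c)))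

  *-distribʳ-+ : ∀ a b c → (b + c) * a ≡ b * a + c * a
  *-distribʳ-+ a b c = trans (*-comm (b + c) a)
    (trans (*-distribˡ-+ a b c) (cong₂ _+_ (*-comm a b) (*-comm a c)))

  commutativeRing : CommutativeRing 0ℓ 0ℓ
  commutativeRing = record
    { Carrier = ℤ/N
    ; _≈_ = _≡_
    ; _+_ = _+_
    ; _*_ = _*_
    ; -_  = -_
    ; 0#  = 0#
    ; 1#  = 1#
    ; isCommutativeRing = record
      { isRing = record
        { +-isAbelianGroup = record
          { isGroup = record
            { isMonoid = record
              { isSemigroup = record
                { isMagma = record { isEquivalence = isEquivalence ; ∙-cong = cong₂ _+_ }
                ; assoc   = +-assoc
                }
              ; identity = +-identityˡ , λ a → trans (+-comm a 0#) (+-identityˡ a)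
              }
            ; inverse = -‿inverseˡ , λ a → trans (+-comm a (- a)) (-‿inverseˡ a)
            ; ⁻¹-cong = cong (λ a → - a)
            }
          ; comm = +-comm
          }
        ; *-cong     = cong₂ _*_
        ; *-assoc    = *-assoc
        ; *-identity = *-identityˡ , λ a → trans (*-comm a 1#) (*-identityˡ a)
        ; distrib    = *-distribˡ-+ , *-distribʳ-+
        }
      ; *-comm = *-comm
      }
    }

  -- The solver takes its coefficients in ℤ: equality of constants of ℤ/N
  -- does not compute for a variable N.
  private
    reduce-morphism : CommutativeRing.rawRing ℤ.+-*-commutativeRing
                        -Raw-AlmostCommutative⟶ fromCommutativeRing commutativeRing
    reduce-morphism = record
      { ⟦_⟧    = reduce
      ; +-homo = reduce-+
      ; *-homo = reduce-*
      ; -‿homo = λ i → sym (-‿reduce i)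
      ; 0-homo = refl
      ; 1-homo = refl
      }

    coeff≟ : ∀ i j → Maybe (reduce i ≡ reduce j)
    coeff≟ i j = Maybe.map (cong reduce) (dec⇒maybe (i ℤ.≟ j))

  module Solver = RingSolver (CommutativeRing.rawRing ℤ.+-*-commutativeRing)
    (fromCommutativeRing commutativeRing) reduce-morphism coeff≟

  1≢0 : 1# ≢ 0#
  1≢0 1≡0 = contradiction 1≡ℕ0 λ ()
    where
    1≡ℕ0 : 1 ≡ 0
    1≡ℕ0 = begin
      1         ≡⟨ ℕ.m<n⇒m%n≡m (nonTrivial⇒n>1 N) ⟨
      1 ℕ.% N   ≡⟨ toℕ-fromℕ< (n%ℕd<d 1ℤ N) ⟨
      toℕ 1#    ≡⟨ cong toℕ 1≡0 ⟩
      toℕ 0#    ≡⟨ toℕ-fromℕ< (n%ℕd<d 0ℤ N) ⟩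
      0 ℕ.% N   ≡⟨ ℕ.m<n⇒m%n≡m (ℕ.>-nonZero⁻¹ N) ⟩
      0         ∎
      where open ≡-Reasoning

  -- mat a b c d has rows (a , b) and (c , d).
  record Matrix : Set where
    constructor mat
    field a b c d : ℤ/N

  det : Matrix → ℤ/N
  det (mat a b c d) = a * d - b * c

  infixl 7 _·_ _∙_ _⊛_ _▷_ _•_

  _·_ : Matrix → Matrix → Matrix
  mat a b c d · mat a′ b′ c′ d′ =
    mat (a * a′ + b * c′) (a * b′ + b * d′)
        (c * a′ + d * c′) (c * b′ + d * d′)

  det-· : ∀ A B → det (A · B) ≡ det A * det B
  det-· (mat a b c d) (mat a′ b′ c′ d′) =
    solve 8 (λ a b c d a′ b′ c′ d′ →
        (a :* a′ :+ b :* c′) :* (c :* b′ :+ d :* d′) :- (a :* b′ :+ b :* d′) :* (c :* a′ :+ d :* c′)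
        := (a :* d :- b :* c) :* (a′ :* d′ :- b′ :* c′))
      refl a b c d a′ b′ c′ d′
    where open Solver

  record SL₂ : Set where
    constructor sl
    field
      matrix : Matrix
      det≡1  : det matrix ≡ 1#
  open SL₂ public

  identity : SL₂
  identity = sl (mat 1# 0# 0# 1#)
    (solve 0 (con 1ℤ :* con 1ℤ :- con 0ℤ :* con 0ℤ := con 1ℤ) refl)
    where open Solver

  _∙_ : SL₂ → SL₂ → SL₂
  sl A detA ∙ sl B detB =
    sl (A · B) (trans (det-· A B) (trans (cong₂ _*_ detA detB) (*-identityˡ 1#)))

  Vector : Set
  Vector = ℤ/N × ℤ/N

  0ᵥ : Vector
  0ᵥ = 0# , 0#

  _▷_ : Matrix → Vector → Vector
  mat a b c d ▷ (x , y) = a * x + b * y , c * x + d * y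

  _•_ : ℤ/N → Vector → Vector
  c • (x , y) = c * x , c * y

  record NonzeroVector : Set where
    constructor nonzero
    field
      vector : Vector
      ≢0     : vector ≢ 0ᵥ
  open NonzeroVector public

  e₁ e₂ : NonzeroVector
  e₁ = nonzero (1# , 0#) λ eq → 1≢0 (cong proj₁ eq)
  e₂ = nonzero (0# , 1#) λ eq → 1≢0 (cong proj₂ eq)

  ▷-kernel : ∀ (A : SL₂) v → matrix A ▷ v ≡ 0ᵥ → v ≡ 0ᵥ
  ▷-kernel (sl (mat a b c d) det≡1) (x , y) eq = cong₂ _,_
    (begin
      x                                           ≡⟨ *-identityˡ x ⟨
      1# * x                                      ≡⟨ cong (_* x) det≡1 ⟨
      (a * d - b * c) * x                         ≡⟨ solve 6 (λ a b c d x y →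
                                                       (a :* d :- b :* c) :* x :=
                                                       d :* (a :* x :+ b :* y) :- b :* (c :* x :+ d :* y))
                                                       refl a b c d x y ⟩
      d * (a * x + b * y) - b * (c * x + d * y)   ≡⟨ cong₂ (λ p q → d * p - b * q) (cong proj₁ eq) (cong proj₂ eq) ⟩
      d * 0# - b * 0#                             ≡⟨ solve 2 (λ d b → d :* con 0ℤ :- b :* con 0ℤ := con 0ℤ) refl d b ⟩
      0#                                          ∎)
    (begin
      y                                           ≡⟨ *-identityˡ y ⟨
      1# * y                                      ≡⟨ cong (_* y) det≡1 ⟨
      (a * d - b * c) * y                         ≡⟨ solve 6 (λ a b c d x y →
                                                       (a :* d :- b :* c) :* y :=
                                                       a :* (c :* x :+ d :* y) :- c :* (a :* x :+ b :* y))
                                                       refl a b c d x y ⟩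
      a * (c * x + d * y) - c * (a * x + b * y)   ≡⟨ cong₂ (λ p q → a * q - c * p) (cong proj₁ eq) (cong proj₂ eq) ⟩
      a * 0# - c * 0#                             ≡⟨ solve 2 (λ a c → a :* con 0ℤ :- c :* con 0ℤ := con 0ℤ) refl a c ⟩
      0#                                          ∎)
    where
    open ≡-Reasoning
    open Solver

  _⊛_ : SL₂ → NonzeroVector → NonzeroVector
  A ⊛ nonzero v v≢0 = nonzero (matrix A ▷ v) λ eq → v≢0 (▷-kernel A v eq)

  infix 4 _∼′_

  -- Equality of ∼′-classes is expressed by ∼′ between representatives.
  _∼′_ : NonzeroVector → NonzeroVector → Set
  u ∼′ v = ∃ λ c → Invertible _≡_ 1# _*_ c × vector u ≡ c • vector v

  ⊛-cong : ∀ A {u v} → u ∼′ v → A ⊛ u ∼′ A ⊛ v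
  ⊛-cong (sl (mat p q r s) _) {v = nonzero (x , y) _} (c , unit , refl) =
    c , unit , cong₂ _,_ (linear p q) (linear r s)
    where
    open Solver
    linear : ∀ m n → m * (c * x) + n * (c * y) ≡ c * (m * x + n * y)
    linear m n = solve 5 (λ m n c x y → m :* (c :* x) :+ n :* (c :* y) := c :* (m :* x :+ n :* y))
      refl m n c x y

  Word : Set
  Word = List ℤ/N

  π-letter : ℤ/N → SL₂
  π-letter α = sl (mat 0# 1# (- 1#) α)
    (solve 1 (λ α → con 0ℤ :* α :- con 1ℤ :* (:- con 1ℤ) := con 1ℤ) refl α)
    where open Solver

  π : Word → SL₂
  π = foldr (λ α A → π-letter α ∙ A) identity

  Ā : Pred Word 0ℓ
  Ā w = π w ⊛ e₂ ∼′ e₁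

  F^ : ℕ → Pred Word 0ℓ
  F^ l w = length w ≡ l

  Ā^ : ℕ → Pred Word 0ℓ
  Ā^ l = F^ l ∩ Ā

{-# OPTIONS --safe #-}
-- Put π(m) = [p q; r s].  A word lies in Ā exactly when the lower right entry
-- of its image vanishes: the other entry of the second column is then a unit,
-- the determinant being 1.  For the words αm and mα this entry is −q + sα and
-- r + sα respectively, and if one of these vanishes for some α, then
-- ps − qr = 1 makes s a unit, so that each of the two has a unique root.
module Submission where

open import Defs
open import Algebra.Bundles using (CommutativeRing)
open import Algebra.Definitions using (Invertible)
open import Data.Integer.Base using (0ℤ; 1ℤ)
open import Data.List.Base using ([]; _∷_; _∷ʳ_; length; InitLast; initLast; _∷ʳ′_)
open import Data.List.Properties using (∷ʳ-injectiveˡ; length-++-comm)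
open import Data.Nat.Base using (ℕ; NonTrivial; NonZero; ≢-nonZero⁻¹)
open import Data.Product using (_×_; ∃; ∃!; _,_; proj₁; proj₂)
open import Function.Base using (_∘_)
open import Function.Bundles using (_⇔_; mk⇔; module Equivalence)
open import Relation.Binary.PropositionalEquality
  using (_≡_; refl; sym; trans; cong; cong₂; module ≡-Reasoning)
open import Relation.Nullary.Negation using (contradiction)
open import Relation.Unary using (_∈_; _∉_)

module _ (N : ℕ) .{{_ : NonTrivial N}} where
  open Modulo N
  open CommutativeRing commutativeRing using (*-identityʳ; zeroʳ)
  open Matrix
  open Solver
  open ≡-Reasoning

  -- Multiplying `t + s * x ≡ 0#` by the inverse `u` of `s` forces `x` to be `- (u * t)`, and this
  -- value is a root. Membership of `α ∷ m` and of `m ∷ʳ α` in `Ā` is brought to this form below.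
  root-unique : ∀ s t → (∃ λ u → s * u ≡ 1#) → ∃! _≡_ (λ x → t + s * x ≡ 0#)
  root-unique s t (u , su≡1) = - (u * t) , isRoot , unique
    where
    isRoot : t + s * - (u * t) ≡ 0#
    isRoot = begin
      t + s * - (u * t)  ≡⟨ solve 3 (λ s u t → t :+ s :* :- (u :* t) := t :- (s :* u) :* t) refl s u t ⟩
      t - (s * u) * t    ≡⟨ cong (λ k → t - k * t) su≡1 ⟩
      t - 1# * t         ≡⟨ solve 1 (λ t → t :- con 1ℤ :* t := con 0ℤ) refl t ⟩
      0#                 ∎

    unique : ∀ {x} → t + s * x ≡ 0# → - (u * t) ≡ x
    unique {x} eq = begin
      - (u * t)                      ≡⟨ solve 4 (λ s u t x → :- (u :* t) := (s :* u) :* x :- u :* (t :+ s :* x)) refl s u t x ⟩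
      (s * u) * x - u * (t + s * x)  ≡⟨ cong₂ (λ k z → k * x - u * z) su≡1 eq ⟩
      1# * x - u * 0#                ≡⟨ solve 2 (λ x u → con 1ℤ :* x :- u :* con 0ℤ := x) refl x u ⟩
      x                              ∎

  mat-cong : ∀ {a a′ b b′ c c′ d d′} → a ≡ a′ → b ≡ b′ → c ≡ c′ → d ≡ d′ →
             mat a b c d ≡ mat a′ b′ c′ d′
  mat-cong refl refl refl refl = refl

  ·-assoc : ∀ A B C → (A · B) · C ≡ A · (B · C)
  ·-assoc (mat a b c d) (mat a′ b′ c′ d′) (mat a″ b″ c″ d″) =
    mat-cong (entry a b a″ c″) (entry a b b″ d″) (entry c d a″ c″) (entry c d b″ d″)
    where
    entry : ∀ x y z w → (x * a′ + y * c′) * z + (x * b′ + y * d′) * w ≡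
                        x * (a′ * z + b′ * w) + y * (c′ * z + d′ * w)
    entry x y z w = solve 8 (λ x y z w a b c d →
        (x :* a :+ y :* c) :* z :+ (x :* b :+ y :* d) :* w :=
        x :* (a :* z :+ b :* w) :+ y :* (c :* z :+ d :* w))
      refl x y z w a′ b′ c′ d′

  ·-identityˡ : ∀ A → matrix identity · A ≡ A
  ·-identityˡ (mat a b c d) = mat-cong (top a c) (top b d) (bottom a c) (bottom b d)
    where
    top : ∀ x y → 1# * x + 0# * y ≡ x
    top = solve 2 (λ x y → con 1ℤ :* x :+ con 0ℤ :* y := x) refl
    bottom : ∀ x y → 0# * x + 1# * y ≡ y
    bottom = solve 2 (λ x y → con 0ℤ :* x :+ con 1ℤ :* y := y) refl

  ·-identityʳ : ∀ A → A · matrix identity ≡ A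
  ·-identityʳ (mat a b c d) = mat-cong (left a b) (right a b) (left c d) (right c d)
    where
    left : ∀ x y → x * 1# + y * 0# ≡ x
    left = solve 2 (λ x y → x :* con 1ℤ :+ y :* con 0ℤ := x) refl
    right : ∀ x y → x * 0# + y * 1# ≡ y
    right = solve 2 (λ x y → x :* con 0ℤ :+ y :* con 1ℤ := y) refl

  -- `π` folds from the right, so only a first letter splits off by computation. A last letter has
  -- to be carried through the product by associativity.
  π-∷ʳ : ∀ m α → matrix (π (m ∷ʳ α)) ≡ matrix (π m) · matrix (π-letter α)
  π-∷ʳ []      α = trans (·-identityʳ (matrix (π-letter α))) (sym (·-identityˡ (matrix (π-letter α))))
  π-∷ʳ (β ∷ m) α = trans (cong (matrix (π-letter β) ·_) (π-∷ʳ m α))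
    (sym (·-assoc (matrix (π-letter β)) (matrix (π m)) (matrix (π-letter α))))

  ▷e₂ : ∀ A → A ▷ vector e₂ ≡ (b A , d A)
  ▷e₂ (mat p q r s) = cong₂ _,_ (entry p q) (entry r s)
    where
    entry : ∀ x y → x * 0# + y * 1# ≡ y
    entry = solve 2 (λ x y → x :* con 0ℤ :+ y :* con 1ℤ := y) refl

  •e₁ : ∀ k → k • vector e₁ ≡ (k , 0#)
  •e₁ k = cong₂ _,_ (*-identityʳ k) (zeroʳ k)

  d≡0⇒b-unit : ∀ (A : SL₂) → d (matrix A) ≡ 0# → Invertible _≡_ 1# _*_ (b (matrix A))
  d≡0⇒b-unit (sl (mat p q r s) det≡1) s≡0 = - r , trans (*-comm (- r) q) q*-r≡1 , q*-r≡1
    where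
    q*-r≡1 : q * - r ≡ 1#
    q*-r≡1 = begin
      -- The term `p * 0#` is inserted so that replacing `0#` by `s` yields the determinant.
      q * - r         ≡⟨ solve 3 (λ p q r → q :* :- r := p :* con 0ℤ :- q :* r) refl p q r ⟩
      p * 0# - q * r  ≡⟨ cong (λ z → p * z - q * r) s≡0 ⟨
      p * s - q * r   ≡⟨ det≡1 ⟩
      1#              ∎

  ⊛e₂∼′e₁⇒d≡0 : ∀ A → A ⊛ e₂ ∼′ e₁ → d (matrix A) ≡ 0#
  ⊛e₂∼′e₁⇒d≡0 A (k , _ , eq) = begin
    d (matrix A)                      ≡⟨ cong proj₂ (▷e₂ (matrix A)) ⟨
    proj₂ (matrix A ▷ vector e₂)      ≡⟨ cong proj₂ eq ⟩
    proj₂ (k • vector e₁)             ≡⟨ cong proj₂ (•e₁ k) ⟩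
    0#                                ∎

  -- The second column is then `(b , 0)`, so the scalar relating it to `e₁` is `b` itself.
  d≡0⇒⊛e₂∼′e₁ : ∀ A → d (matrix A) ≡ 0# → A ⊛ e₂ ∼′ e₁
  d≡0⇒⊛e₂∼′e₁ A d≡0 = b (matrix A) , d≡0⇒b-unit A d≡0 , (begin
    matrix A ▷ vector e₂              ≡⟨ ▷e₂ (matrix A) ⟩
    (b (matrix A) , d (matrix A))     ≡⟨ cong (b (matrix A) ,_) d≡0 ⟩
    (b (matrix A) , 0#)               ≡⟨ •e₁ (b (matrix A)) ⟨
    b (matrix A) • vector e₁          ∎)

  Ā⇔d≡0 : ∀ w → w ∈ Ā ⇔ d (matrix (π w)) ≡ 0#
  Ā⇔d≡0 w = mk⇔ (⊛e₂∼′e₁⇒d≡0 (π w)) (d≡0⇒⊛e₂∼′e₁ (π w))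

  module _ (m : Word) where
    private
      M = matrix (π m)

    -- The bottom row `(- 1# , α)` of `π-letter α` meets the second column of `M`.
    ∷-∈Ā⇔ : ∀ α → α ∷ m ∈ Ā ⇔ - b M + d M * α ≡ 0#
    ∷-∈Ā⇔ α = mk⇔ (trans (sym d≡) ∘ Equivalence.to (Ā⇔d≡0 (α ∷ m)))
                   (Equivalence.from (Ā⇔d≡0 (α ∷ m)) ∘ trans d≡)
      where
      d≡ : d (matrix (π (α ∷ m))) ≡ - b M + d M * α
      d≡ = solve 3 (λ q s α → :- con 1ℤ :* q :+ α :* s := :- q :+ s :* α) refl (b M) (d M) α

    -- The bottom row of `M` meets the second column `(1# , α)` of `π-letter α`.
    ∷ʳ-∈Ā⇔ : ∀ α → m ∷ʳ α ∈ Ā ⇔ c M + d M * α ≡ 0#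
    ∷ʳ-∈Ā⇔ α = mk⇔ (trans (sym d≡) ∘ Equivalence.to (Ā⇔d≡0 (m ∷ʳ α)))
                    (Equivalence.from (Ā⇔d≡0 (m ∷ʳ α)) ∘ trans d≡)
      where
      d≡ : d (matrix (π (m ∷ʳ α))) ≡ c M + d M * α
      d≡ = trans (cong d (π-∷ʳ m α))
        (solve 3 (λ r s α → r :* con 1ℤ :+ s :* α := r :+ s :* α) refl (c M) (d M) α)

    ∷-∈Ā⇒d-unit : ∀ α → α ∷ m ∈ Ā → ∃ λ u → d M * u ≡ 1#
    -- Membership says b = dα. Substituting this in ad - bc = 1 gives d(a - cα) = 1.
    ∷-∈Ā⇒d-unit α αm∈Ā = a M - c M * α , (begin
      d M * (a M - c M * α)              ≡⟨ solve 5 (λ p q r s α →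
                                              s :* (p :- r :* α) := p :* s :- q :* r :- r :* (:- q :+ s :* α))
                                              refl (a M) (b M) (c M) (d M) α ⟩
      det M - c M * (- b M + d M * α)    ≡⟨ cong₂ (λ k z → k - c M * z) (det≡1 (π m)) (Equivalence.to (∷-∈Ā⇔ α) αm∈Ā) ⟩
      1# - c M * 0#                      ≡⟨ solve 1 (λ r → con 1ℤ :- r :* con 0ℤ := con 1ℤ) refl (c M) ⟩
      1#                                 ∎)

    ∷ʳ-∈Ā⇒d-unit : ∀ α → m ∷ʳ α ∈ Ā → ∃ λ u → d M * u ≡ 1#
    -- Here c = -dα, and ad - bc = 1 becomes d(a + bα) = 1.
    ∷ʳ-∈Ā⇒d-unit α mα∈Ā = a M + b M * α , (begin
      d M * (a M + b M * α)              ≡⟨ solve 5 (λ p q r s α →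
                                              s :* (p :+ q :* α) := p :* s :- q :* r :+ q :* (r :+ s :* α))
                                              refl (a M) (b M) (c M) (d M) α ⟩
      det M + b M * (c M + d M * α)      ≡⟨ cong₂ (λ k z → k + b M * z) (det≡1 (π m)) (Equivalence.to (∷ʳ-∈Ā⇔ α) mα∈Ā) ⟩
      1# + b M * 0#                      ≡⟨ solve 1 (λ q → con 1ℤ :+ q :* con 0ℤ := con 1ℤ) refl (b M) ⟩
      1#                                 ∎)

    -- The two sides are linked through the entry `d M`: an extension on the right makes it a unit,
    -- which makes the linear equation for an extension on the left uniquely solvable.
    ∷-unique-in-Ā : ∀ α → m ∷ʳ α ∈ Ā → ∃! _≡_ (λ β → β ∷ m ∈ Ā)
    ∷-unique-in-Ā α mα∈Ā = transport (root-unique (d M) (- b M) (∷ʳ-∈Ā⇒d-unit α mα∈Ā))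
      where
      transport : ∃! _≡_ (λ β → - b M + d M * β ≡ 0#) → ∃! _≡_ (λ β → β ∷ m ∈ Ā)
      transport (β , root , unique) =
        β , Equivalence.from (∷-∈Ā⇔ β) root , λ {γ} γm∈Ā → unique (Equivalence.to (∷-∈Ā⇔ γ) γm∈Ā)

    ∷ʳ-unique-in-Ā : ∀ α → α ∷ m ∈ Ā → ∃! _≡_ (λ β → m ∷ʳ β ∈ Ā)
    ∷ʳ-unique-in-Ā α αm∈Ā = transport (root-unique (d M) (c M) (∷-∈Ā⇒d-unit α αm∈Ā))
      where
      transport : ∃! _≡_ (λ β → c M + d M * β ≡ 0#) → ∃! _≡_ (λ β → m ∷ʳ β ∈ Ā)
      transport (β , root , unique) =
        β , Equivalence.from (∷ʳ-∈Ā⇔ β) root , λ {γ} mγ∈Ā → unique (Equivalence.to (∷ʳ-∈Ā⇔ γ) mγ∈Ā)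

  -- Disposes of the word that has no letter to drop at either end.
  []∉Ā^ : ∀ l → .{{_ : NonZero l}} → [] ∉ Ā^ l
  []∉Ā^ l (0≡l , _) = contradiction (sym 0≡l) (≢-nonZero⁻¹ l)

  successor-unique : ∀ l → .{{_ : NonZero l}} → ∀ w → w ∈ Ā^ l →
                     ∃! _≡_ (λ w′ → w′ ∈ Ā^ l × w′ ImmediateSuccessorOf w)
  successor-unique l []      w∈Āˡ         = contradiction w∈Āˡ ([]∉Ā^ l)
  successor-unique l (α ∷ m) (len , αm∈Ā) = extend (∷ʳ-unique-in-Ā m α αm∈Ā)
    where
    extend : ∃! _≡_ (λ β → m ∷ʳ β ∈ Ā) → ∃! _≡_ (λ w′ → w′ ∈ Ā^ l × w′ ImmediateSuccessorOf (α ∷ m))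
    extend (β , mβ∈Ā , unique) =
      m ∷ʳ β ,
      -- Lengths ignore the letters, so `length (β ∷ m)` and `length (α ∷ m)` agree by computation
      -- and `len` applies.
      ((trans (length-++-comm m (β ∷ [])) len , mβ∈Ā) , immediateSuccessor α m β refl refl) ,
      -- Matching `α ∷ m ≡ first ∷ middle` identifies `middle` with `m`, so every successor has the
      -- form `m ∷ʳ γ`.
      λ { ((_ , mγ∈Ā) , immediateSuccessor _ _ _ refl refl) → cong (m ∷ʳ_) (unique mγ∈Ā) }

  predecessor-unique : ∀ l → .{{_ : NonZero l}} → ∀ w → w ∈ Ā^ l →
                       ∃! _≡_ (λ w′ → w′ ∈ Ā^ l × w′ ImmediatePredecessorOf w)
  predecessor-unique l w = cases (initLast w)
    where
    extend : ∀ m α → length (m ∷ʳ α) ≡ l → ∃! _≡_ (λ β → β ∷ m ∈ Ā) →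
             ∃! _≡_ (λ w′ → w′ ∈ Ā^ l × w′ ImmediatePredecessorOf (m ∷ʳ α))
    extend m α len (β , βm∈Ā , unique) =
      β ∷ m ,
      ((trans (length-++-comm (α ∷ []) m) len , βm∈Ā) , immediateSuccessor β m α refl refl) ,
      -- Since `_∷ʳ_` is not a constructor, `mα≡m′δ` cannot be matched with `refl`. Injectivity
      -- extracts `m ≡ m′`, which can be matched once `m′` is a variable of its own.
      λ { ((_ , γm′∈Ā) , immediateSuccessor γ m′ _ refl mα≡m′δ) →
          βm≡γm′ γ (∷ʳ-injectiveˡ m m′ mα≡m′δ) γm′∈Ā }
      where
      βm≡γm′ : ∀ γ {m′} → m ≡ m′ → γ ∷ m′ ∈ Ā → β ∷ m ≡ γ ∷ m′
      βm≡γm′ γ refl γm∈Ā = cong (_∷ m) (unique γm∈Ā)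

    cases : ∀ {w} → InitLast w → w ∈ Ā^ l →
            ∃! _≡_ (λ w′ → w′ ∈ Ā^ l × w′ ImmediatePredecessorOf w)
    cases []        w∈Āˡ         = contradiction w∈Āˡ ([]∉Ā^ l)
    cases (m ∷ʳ′ α) (len , mα∈Ā) = extend m α len (∷-unique-in-Ā m α mα∈Ā)

theorem5p3 : (N l : ℕ) .{{_ : NonTrivial N}} .{{_ : NonZero l}} → let open Modulo N in
    (w : Word) → w ∈ Ā^ l →
    ∃! _≡_ (λ w′ → w′ ∈ Ā^ l × w′ ImmediateSuccessorOf w) ×
    ∃! _≡_ (λ w′ → w′ ∈ Ā^ l × w′ ImmediatePredecessorOf w)
theorem5p3 N l w w∈Āˡ = successor-unique N l w w∈Āˡ , predecessor-unique N l w w∈Āˡ
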